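{- Let $S$ be a finite set and let $\mathcal{I}\subseteq 2^S$ be a downset of the Boolean lattice $(2^S,\subseteq)$ (i.e., $Y\subseteq X\in\mathcal{I}$ implies $Y\in\mathcal{I}$). Suppose that there exists $Z\in\mathcal{I}$ with $\hat\mu_{\mathcal{I}}(Z)=0$, and fix such a $Z$. Then $$\mathcal{I}\in \bullet\big(\{\,2^X \mid X\in \mathcal{I}\setminus\{Z\}\,\}\big),$$ where $2^X=\{Y\subseteq S\mid Y\subseteq X\}$ is the principal downset generated by $X$.
   Context: For a finite set $S$ and a configuration $\mathcal{C}\subseteq 2^S$, the generalized Möbius function $\hat\mu_{\mathcal{C}}:2^S\to\mathbb{Z}$ is defined by top-down induction: $\hat\mu_{\mathcal{C}}(X)=[X\in\mathcal{C}]-\sum_{X\subsetneq X'\subseteq S}\hat\mu_{\mathcal{C}}(X')$, where $[X\in\mathcal{C}]$ is $1$ if $X\in\mathcal{C}$ and $0$ otherwise. For sets $A,B$, the disjoint union $A\,\dot\cup\, B$ is $A\cup B$ and is defined only when $A\cap B=\emptyset$; the subset complement $A\,\dot\setminus\, B$ is $A\setminus B$ and is defined only when $B\subseteq A$. For a finite family $\mathcal{F}$ of sets, the partial dot-algebra $\bullet(\mathcal{F})$ is the smallest family of sets that contains $\emptyset$ and every member of $\mathcal{F}$ and is closed under all well-defined disjoint unions and subset complements of its members. Here the members of $\mathcal{F}$ are themselves sets of subsets of $S$, so $\bullet(\mathcal{F})$ consists of subsets of $2^S$. -}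

module Defs where

open import Data.Bool.Base using (if_then_else_)
open import Data.Fin.Subset using (Subset; inside; outside; _⊂_; _⊃_)
  renaming (_⊆_ to _⊆ˢ_)
open import Data.Fin.Subset.Induction using (⊃-wellFounded)
open import Data.Fin.Subset.Properties using (_⊂?_)
open import Data.Integer.Base using (ℤ; 0ℤ; 1ℤ; _+_; _-_)
open import Data.Nat.Base using (ℕ; zero; suc)
open import Data.Vec.Base using ([]; _∷_)
open import Induction.WellFounded using (WfRec; module All; module FixPoint)
open import Level using (Level; 0ℓ; _⊔_) renaming (suc to lsuc)
open import Relation.Binary.PropositionalEquality using (_≡_; refl; cong; cong₂)
open import Relation.Nullary using (Dec; yes; no; does)
open import Relation.Unary
  using (Pred; Decidable; ∅; _∈_; _⊆_; _≐_; _∪_; _∖_; _⊥_)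

-- The finite set S is Fin n, so 2^S is Subset n.  A configuration is a
-- predicate on Subset n; it is assumed decidable where its indicator is used.

Configuration : ℕ → Set₁
Configuration n = Pred (Subset n) 0ℓ

IsDownset : ∀ {n} → Configuration n → Set
IsDownset {n} C = ∀ {X Y : Subset n} → Y ⊆ˢ X → X ∈ C → Y ∈ C

2^ : ∀ {n} → Subset n → Configuration n
2^ X = λ Y → Y ⊆ˢ X

𝟙 : ∀ {p} {P : Set p} → Dec P → ℤ
𝟙 P? = if does P? then 1ℤ else 0ℤ

-- Sum over all subsets of Fin n, split on membership of the first element.
∑ : ∀ {n} → (Subset n → ℤ) → ℤ
∑ {zero}  f = f []
∑ {suc n} f = ∑ (λ X → f (outside ∷ X)) + ∑ (λ X → f (inside ∷ X))

module _ {n : ℕ} {C : Configuration n} (C? : Decidable C) where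

  private
    term : ∀ {X X′ : Subset n} → WfRec _⊃_ (λ _ → ℤ) X → Dec (X ⊂ X′) → ℤ
    term μ (yes X⊂X′) = μ X⊂X′
    term μ (no  _)    = 0ℤ

    step : ∀ X → WfRec _⊃_ (λ _ → ℤ) X → ℤ
    step X μ = 𝟙 (C? X) - ∑ (λ X′ → term μ (X ⊂? X′))

  -- The generalized Möbius function of C, by well-founded recursion on
  -- proper supersets; μ̂-rec is its defining equation.
  μ̂ : Subset n → ℤ
  μ̂ = All.wfRec ⊃-wellFounded 0ℓ (λ _ → ℤ) step

  private
    ∑-cong : ∀ {m} {f g : Subset m → ℤ} → (∀ X → f X ≡ g X) → ∑ f ≡ ∑ g
    ∑-cong {zero}  f≗g = f≗g []
    ∑-cong {suc m} f≗g =
      cong₂ _+_ (∑-cong (λ X → f≗g (outside ∷ X))) (∑-cong (λ X → f≗g (inside ∷ X)))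

    term-ext : ∀ {X X′} {μ ν : WfRec _⊃_ (λ _ → ℤ) X} →
               (∀ {Y} (X⊂Y : X ⊂ Y) → μ X⊂Y ≡ ν X⊂Y) →
               (d : Dec (X ⊂ X′)) → term μ d ≡ term ν d
    term-ext μ≗ν (yes X⊂X′) = μ≗ν X⊂X′
    term-ext μ≗ν (no  _)    = refl

    step-ext : ∀ X {μ ν : WfRec _⊃_ (λ _ → ℤ) X} →
               (∀ {Y} (X⊂Y : X ⊂ Y) → μ X⊂Y ≡ ν X⊂Y) → step X μ ≡ step X ν
    step-ext X μ≗ν =
      cong (𝟙 (C? X) -_) (∑-cong (λ X′ → term-ext μ≗ν (X ⊂? X′)))

    term-if : ∀ {X X′} (d : Dec (X ⊂ X′)) →
              term (λ {Y} _ → μ̂ Y) d ≡ (if does d then μ̂ X′ else 0ℤ)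
    term-if (yes _) = refl
    term-if (no  _) = refl

  μ̂-rec : ∀ X → μ̂ X ≡ 𝟙 (C? X) - ∑ (λ X′ → if does (X ⊂? X′) then μ̂ X′ else 0ℤ)
  μ̂-rec X
    rewrite FixPoint.unfold-wfRec ⊃-wellFounded (λ _ → ℤ) step step-ext {X}
    = cong (𝟙 (C? X) -_) (∑-cong (λ X′ → term-if (X ⊂? X′)))

-- The partial dot-algebra of a family F of sets of elements of A.  Sets are
-- predicates, so set equality is mutual inclusion _≐_, and resp-≐ closes the
-- algebra under it.
data • {a ℓ : Level} {A : Set a} (F : Pred (Pred A 0ℓ) ℓ) :
       Pred (Pred A 0ℓ) (a ⊔ lsuc 0ℓ ⊔ ℓ) where
  empty      : ∅ ∈ • F
  generator  : ∀ {P} → P ∈ F → P ∈ • F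
  union      : ∀ {P Q} → P ∈ • F → Q ∈ • F → P ⊥ Q → (P ∪ Q) ∈ • F
  complement : ∀ {P Q} → P ∈ • F → Q ∈ • F → Q ⊆ P → (P ∖ Q) ∈ • F
  resp-≐     : ∀ {P Q} → P ≐ Q → P ∈ • F → Q ∈ • F

{-# OPTIONS --safe #-}

-- Write D for the dot-algebra and p for the parity of ∣Z∣.  Removing from 2^Y
-- the smaller fibres of X ↦ X ∪ K shows that D contains the fibre over Y ∈ I
-- whenever no set between K and Y equals Z.  For K = ∅ these are the singletons
-- {Y} with Z ⊈ Y, for K = {a} with a ∉ Z the edges {Y, Y - a} of the hypercube.
-- Three consecutive edges of a path give the pair of its endpoints as
-- {x, y} ∪ {x′, y′} ∖ {x′, y}, and every set of I above Z is joined to Z by a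
-- descending path, so D contains every pair of sets of I above Z with opposite
-- parities.  By Möbius inversion μ̂ Z is the number of sets of I above Z with
-- parity p minus the number of those with the opposite parity; since it
-- vanishes, the sets of I above Z are a disjoint union of such pairs.

module Submission where

open import Defs
open import Algebra.Properties.CommutativeSemigroup using (interchange)
open import Data.Bool.Base using (if_then_else_)
open import Data.Bool.Properties using (∨-identityʳ) renaming (_≟_ to _≟ᵇ_)
open import Data.Fin.Base using (Fin; zero; suc)
open import Data.Fin.Subset using (Subset; inside; outside; ⁅_⁆; ∣_∣; _⊂_; _-_)
  renaming (_∈_ to _∈ˢ_; _∉_ to _∉ˢ_; _⊆_ to _⊆ˢ_; _⊈_ to _⊈ˢ_; _∪_ to _∪ˢ_; ⊥ to ⊥ˢ)
open import Data.Fin.Subset.Induction using (⊂-wellFounded)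
open import Data.Fin.Subset.Properties
  using (_∈?_; _⊆?_; _⊂?_; ⊆-antisym; ⊆-refl; ⊆-trans; ⊂-irref; ⊥⊆; drop-∷-⊆;
         ∪-identityʳ; p─⊥≡p; p⊆p∪q; q⊆p∪q; x∈p∪q⁻; x∈⁅x⁆; x∈⁅y⁆⇒x≡y; x∈p∧x≢y⇒x∈p-y; x∈p⇒p-x⊂p;
         out⊆; s⊆s)
open import Data.Integer.Base using (ℤ; +_; 0ℤ; 1ℤ; _+_) renaming (_-_ to _-ᶻ_; -_ to -ᶻ_)
open import Data.Integer.Properties
  using (+-identityˡ; +-identityʳ; +-assoc; +-comm; +-inverseˡ; +-injective;
         +-commutativeSemigroup)
open import Data.List.Base using (List; []; _∷_; [_]; _++_; map; filter; foldr; length)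
open import Data.List.Membership.Propositional using () renaming (_∈_ to _∈ᴸ_)
open import Data.List.Membership.Propositional.Properties
  using (∈-map⁺; ∈-map⁻; ∈-++⁺ˡ; ∈-++⁺ʳ; ∈-++⁻; ∈-filter⁺; ∈-filter⁻)
open import Data.List.Relation.Unary.Any using (here; there)
open import Data.List.Relation.Unary.AllPairs using ([]; _∷_)
open import Data.List.Relation.Unary.All using ([])
open import Data.List.Relation.Unary.Unique.Propositional using (Unique)
import Data.List.Relation.Unary.Unique.Propositional.Properties as Unique
open import Data.Nat.Base using (ℕ; zero; suc; parity)
open import Data.Nat.Properties using (suc-injective)
open import Data.Parity.Base using (Parity; 0ℙ; 1ℙ; _⁻¹)
open import Data.Parity.Properties
  using (⁻¹-injective; ⁻¹-involutive; p≢p⁻¹; suc-homo-⁻¹)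
open import Data.Product.Base using (∃-syntax; _×_; _,_; proj₁; proj₂)
open import Data.Sum.Base as Sum using (_⊎_; inj₁; inj₂)
open import Data.Vec.Base using ([]; _∷_; here; there)
open import Data.Vec.Properties using (≡-dec; ∷-injectiveʳ)
open import Function.Base using (_∘_; id)
open import Induction.WellFounded using (Acc; acc)
open import Level using (Level; 0ℓ)
open import Relation.Binary.Definitions using (DecidableEquality)
open import Relation.Binary.PropositionalEquality
  using (_≡_; _≢_; refl; sym; trans; cong; cong₂; module ≡-Reasoning)
open import Relation.Nullary using (¬_; yes; no; does; contradiction)
open import Relation.Nullary.Decidable using (_×-dec_; ¬?)
open import Relation.Unary using (Pred; Decidable; _∈_; _∖_; ｛_｝; _≐_; _⊥_; _∪_)

private
  variable
    n : ℕ
    ℓ : Level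
    A : Set

-- Adding or removing one element, and the parity of the cardinality.

_≟ˢ_ : DecidableEquality (Subset n)
_≟ˢ_ = ≡-dec _≟ᵇ_

⊆∧⊄⇒≡ : {X Y : Subset n} → X ⊆ˢ Y → ¬ (X ⊂ Y) → X ≡ Y
⊆∧⊄⇒≡ {X = X} {Y} X⊆Y X⊄Y = ⊆-antisym X⊆Y Y⊆X
  where
  Y⊆X : Y ⊆ˢ X
  Y⊆X {a} a∈Y with a ∈? X
  ... | yes a∈X = a∈X
  ... | no  a∉X = contradiction ((λ {x} → X⊆Y {x}) , a , a∈Y , a∉X) X⊄Y

-- Bounds the fibre of adjoining `a` over a set `Y`: its only possible members are `Y` and `Y - a`.
∪⁅⁆-undo : (X : Subset n) (a : Fin n) → X ∪ˢ ⁅ a ⁆ ≡ X ⊎ (X ∪ˢ ⁅ a ⁆) - a ≡ X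
∪⁅⁆-undo (inside  ∷ X) zero    = inj₁ (cong (inside ∷_) (∪-identityʳ X))
∪⁅⁆-undo (outside ∷ X) zero    =
  inj₂ (cong (outside ∷_) (trans (p─⊥≡p _) (∪-identityʳ X)))
∪⁅⁆-undo (x       ∷ X) (suc a) =
  Sum.map (cong₂ _∷_ (∨-identityʳ x)) (cong₂ _∷_ (∨-identityʳ x)) (∪⁅⁆-undo X a)

∪⁅⁆-absorb : {X : Subset n} {a : Fin n} → a ∈ˢ X → X ∪ˢ ⁅ a ⁆ ≡ X
∪⁅⁆-absorb {X = inside ∷ X} here        = cong (inside ∷_) (∪-identityʳ X)
∪⁅⁆-absorb {X = x ∷ X}      (there a∈X) = cong₂ _∷_ (∨-identityʳ x) (∪⁅⁆-absorb a∈X)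

-∪⁅⁆ : {X : Subset n} {a : Fin n} → a ∈ˢ X → (X - a) ∪ˢ ⁅ a ⁆ ≡ X
-∪⁅⁆ {X = inside ∷ X} here        = cong (inside ∷_) (trans (∪-identityʳ _) (p─⊥≡p X))
-∪⁅⁆ {X = x ∷ X}      (there a∈X) = cong₂ _∷_ (∨-identityʳ x) (-∪⁅⁆ a∈X)

parity-suc : ∀ k → parity (suc k) ≡ parity k ⁻¹
parity-suc k = ⁻¹-injective (trans (suc-homo-⁻¹ k) (sym (⁻¹-involutive _)))

parity-remove : {X : Subset n} {a : Fin n} → a ∈ˢ X → parity ∣ X - a ∣ ≡ parity ∣ X ∣ ⁻¹
parity-remove {X = inside ∷ X} here =
  trans (cong (parity ∘ ∣_∣) (p─⊥≡p X)) (sym (suc-homo-⁻¹ ∣ X ∣))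
parity-remove {X = outside ∷ X} (there a∈X) = parity-remove a∈X
parity-remove {X = inside ∷ X} {suc a} (there a∈X) =
  trans (parity-suc ∣ X - a ∣)
        (cong _⁻¹ (trans (parity-remove a∈X) (sym (parity-suc ∣ X ∣))))

-- Möbius inversion above a set

total : (A → ℤ) → List A → ℤ
total f = foldr (λ x s → f x + s) 0ℤ

total-++ : (f : A → ℤ) (xs ys : List A) → total f (xs ++ ys) ≡ total f xs + total f ys
total-++ f []       ys = sym (+-identityˡ _)
total-++ f (x ∷ xs) ys = trans (cong (_+_ (f x)) (total-++ f xs ys)) (sym (+-assoc (f x) _ _))

total-map : {B : Set} (f : B → ℤ) (g : A → B) (xs : List A) →
            total f (map g xs) ≡ total (f ∘ g) xs
total-map f g []       = refl
total-map f g (x ∷ xs) = cong (_+_ (f (g x))) (total-map f g xs)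

total-cong : {f g : A → ℤ} → (∀ x → f x ≡ g x) → (xs : List A) → total f xs ≡ total g xs
total-cong f≗g []       = refl
total-cong f≗g (x ∷ xs) = cong₂ _+_ (f≗g x) (total-cong f≗g xs)

total-+ : (f g : A → ℤ) (xs : List A) → total (λ x → f x + g x) xs ≡ total f xs + total g xs
total-+ f g []       = refl
total-+ f g (x ∷ xs) =
  trans (cong (_+_ (f x + g x)) (total-+ f g xs))
        (interchange +-commutativeSemigroup (f x) (g x) _ _)

total-𝟙 : {P : Pred A 0ℓ} (P? : Decidable P) (xs : List A) →
          total (𝟙 ∘ P?) xs ≡ + length (filter P? xs)
total-𝟙 P? []       = refl
total-𝟙 P? (x ∷ xs) with P? x
... | yes _ = cong (_+_ 1ℤ) (total-𝟙 P? xs)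
... | no  _ = trans (+-identityˡ _) (total-𝟙 P? xs)

-- Written with `if does` so that `∑⊃` has literally the form of the sum in `μ̂-rec`.
∑⊇ ∑⊃ : (Subset n → ℤ) → Subset n → ℤ
∑⊇ f X = ∑ λ X′ → if does (X ⊆? X′) then f X′ else 0ℤ
∑⊃ f X = ∑ λ X′ → if does (X ⊂? X′) then f X′ else 0ℤ

∑-0 : ∀ n → ∑ {n} (λ _ → 0ℤ) ≡ 0ℤ
∑-0 zero    = refl
∑-0 (suc n) = cong₂ _+_ (∑-0 n) (∑-0 n)

∑⊇-inside : (f : Subset (suc n) → ℤ) (X : Subset n) →
            ∑⊇ f (inside ∷ X) ≡ ∑⊇ (f ∘ (inside ∷_)) X
∑⊇-inside {n} f X = trans (cong (_+ ∑⊇ (f ∘ (inside ∷_)) X) (∑-0 n)) (+-identityˡ _)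

∑⊃-inside : (f : Subset (suc n) → ℤ) (X : Subset n) →
            ∑⊃ f (inside ∷ X) ≡ ∑⊃ (f ∘ (inside ∷_)) X
∑⊃-inside {n} f X = trans (cong (_+ ∑⊃ (f ∘ (inside ∷_)) X) (∑-0 n)) (+-identityˡ _)

-- By induction on `X`. When `X` omits the first element, every superset containing it is proper, so
-- that half already agrees on both sides.
∑⊃+self : (f : Subset n → ℤ) (X : Subset n) → ∑⊃ f X + f X ≡ ∑⊇ f X
∑⊃+self f []            = +-identityˡ _
∑⊃+self f (inside ∷ X)  =
  trans (cong (_+ f (inside ∷ X)) (∑⊃-inside f X)) (trans (∑⊃+self _ X) (sym (∑⊇-inside f X)))
∑⊃+self f (outside ∷ X) = begin
  (∑⊃ f₀ X + ∑⊇ f₁ X) + f₀ X  ≡⟨ +-assoc (∑⊃ f₀ X) _ _ ⟩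
  ∑⊃ f₀ X + (∑⊇ f₁ X + f₀ X)  ≡⟨ cong (_+_ (∑⊃ f₀ X)) (+-comm (∑⊇ f₁ X) _) ⟩
  ∑⊃ f₀ X + (f₀ X + ∑⊇ f₁ X)  ≡⟨ +-assoc (∑⊃ f₀ X) _ _ ⟨
  (∑⊃ f₀ X + f₀ X) + ∑⊇ f₁ X  ≡⟨ cong (_+ ∑⊇ f₁ X) (∑⊃+self f₀ X) ⟩
  ∑⊇ f₀ X + ∑⊇ f₁ X           ∎
  where
  open ≡-Reasoning
  f₀ = f ∘ (outside ∷_)
  f₁ = f ∘ (inside ∷_)

-- This is the recursion `μ̂-rec` with the sum moved to the other side.
𝟙≡∑⊇μ̂ : {C : Configuration n} (C? : Decidable C) (X : Subset n) → 𝟙 (C? X) ≡ ∑⊇ (μ̂ C?) X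
𝟙≡∑⊇μ̂ C? X = begin
  𝟙 (C? X)                            ≡⟨ +-identityʳ _ ⟨
  𝟙 (C? X) + 0ℤ                       ≡⟨ cong (_+_ (𝟙 (C? X))) (+-inverseˡ s) ⟨
  𝟙 (C? X) + (-ᶻ s + s)               ≡⟨ +-assoc (𝟙 (C? X)) _ s ⟨
  (𝟙 (C? X) -ᶻ s) + s                 ≡⟨ cong (_+ s) (μ̂-rec C? X) ⟨
  μ̂ C? X + s                          ≡⟨ +-comm (μ̂ C? X) s ⟩
  s + μ̂ C? X                          ≡⟨ ∑⊃+self (μ̂ C?) X ⟩
  ∑⊇ (μ̂ C?) X                         ∎
  where
  open ≡-Reasoning
  s = ∑⊃ (μ̂ C?) X

-- The parity is that of the whole cardinality; it flips whenever the first element is taken. The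
-- lists follow the same split on the first element as `∑`, so that sums over them can be compared
-- by induction.
supersets : Subset n → Parity → List (Subset n)
supersets []            0ℙ = [ [] ]
supersets []            1ℙ = []
supersets (inside  ∷ X) p  = map (inside ∷_) (supersets X (p ⁻¹))
supersets (outside ∷ X) p  =
  map (outside ∷_) (supersets X p) ++ map (inside ∷_) (supersets X (p ⁻¹))

supersets-unique : (X : Subset n) → ∀ p → Unique (supersets X p)
supersets-unique [] 0ℙ = [] ∷ []
supersets-unique [] 1ℙ = []
supersets-unique (inside  ∷ X) p = Unique.map⁺ ∷-injectiveʳ (supersets-unique X (p ⁻¹))
supersets-unique (outside ∷ X) p =
  Unique.++⁺ (Unique.map⁺ ∷-injectiveʳ (supersets-unique X p))
             (Unique.map⁺ ∷-injectiveʳ (supersets-unique X (p ⁻¹)))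
             λ (∈out , ∈in) → disjoint (∈-map⁻ _ ∈out) (∈-map⁻ _ ∈in)
  where
  disjoint : ∀ {Y} {P Q : Pred (Subset _) 0ℓ} → ∃[ X ] (P X × Y ≡ outside ∷ X) →
             ¬ (∃[ X ] (Q X × Y ≡ inside ∷ X))
  disjoint (_ , _ , refl) (_ , _ , ())

∈-supersets⁻ : (X : Subset n) → ∀ p {Y} → Y ∈ᴸ supersets X p → X ⊆ˢ Y × parity ∣ Y ∣ ≡ p
∈-supersets⁻ [] 0ℙ (here refl) = ⊆-refl , refl
∈-supersets⁻ (inside ∷ X) p Y∈ with ∈-map⁻ _ Y∈
... | Y′ , Y′∈ , refl with ∈-supersets⁻ X (p ⁻¹) Y′∈
...   | X⊆Y′ , eq = s⊆s X⊆Y′ , trans (parity-suc ∣ Y′ ∣) (trans (cong _⁻¹ eq) (⁻¹-involutive p))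
∈-supersets⁻ (outside ∷ X) p Y∈ with ∈-++⁻ (map (outside ∷_) (supersets X p)) Y∈
... | inj₁ Y∈₀ with ∈-map⁻ _ Y∈₀
...   | Y′ , Y′∈ , refl with ∈-supersets⁻ X p Y′∈
...     | X⊆Y′ , eq = out⊆ X⊆Y′ , eq
∈-supersets⁻ (outside ∷ X) p Y∈ | inj₂ Y∈₁ with ∈-map⁻ _ Y∈₁
...   | Y′ , Y′∈ , refl with ∈-supersets⁻ X (p ⁻¹) Y′∈
...     | X⊆Y′ , eq =
  out⊆ X⊆Y′ , trans (parity-suc ∣ Y′ ∣) (trans (cong _⁻¹ eq) (⁻¹-involutive p))

∈-supersets⁺ : (X : Subset n) → ∀ p {Y} → X ⊆ˢ Y → parity ∣ Y ∣ ≡ p → Y ∈ᴸ supersets X p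
∈-supersets⁺ [] 0ℙ {[]} _ _ = here refl
∈-supersets⁺ (inside ∷ X) p {outside ∷ Y} X⊆Y eq = contradiction (X⊆Y here) λ ()
∈-supersets⁺ (inside ∷ X) p {inside ∷ Y} X⊆Y eq =
  ∈-map⁺ _ (∈-supersets⁺ X (p ⁻¹) (drop-∷-⊆ X⊆Y)
              (trans (sym (suc-homo-⁻¹ ∣ Y ∣)) (cong _⁻¹ eq)))
∈-supersets⁺ (outside ∷ X) p {outside ∷ Y} X⊆Y eq =
  ∈-++⁺ˡ (∈-map⁺ _ (∈-supersets⁺ X p (drop-∷-⊆ X⊆Y) eq))
∈-supersets⁺ (outside ∷ X) p {inside ∷ Y} X⊆Y eq =
  ∈-++⁺ʳ _ (∈-map⁺ _ (∈-supersets⁺ X (p ⁻¹) (drop-∷-⊆ X⊆Y)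
                        (trans (sym (suc-homo-⁻¹ ∣ Y ∣)) (cong _⁻¹ eq))))

total-∑⊇-inside : (f : Subset (suc n) → ℤ) (Xs : List (Subset n)) →
                  total (∑⊇ f) (map (inside ∷_) Xs) ≡ total (∑⊇ (f ∘ (inside ∷_))) Xs
total-∑⊇-inside f Xs = trans (total-map (∑⊇ f) _ Xs) (total-cong (∑⊇-inside f) Xs)

-- Up to sign, the difference of the two sides is the Möbius inverse at Z of the
-- upward sum of f, that is f Z; the equation is kept free of signs.
total-∑⊇-balanced : ∀ p (f : Subset n → ℤ) (Z : Subset n) → f Z ≡ 0ℤ →
                    total (∑⊇ f) (supersets Z p) ≡ total (∑⊇ f) (supersets Z (p ⁻¹))
total-∑⊇-balanced 0ℙ f [] fZ≡0 = trans (+-identityʳ _) fZ≡0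
total-∑⊇-balanced 1ℙ f [] fZ≡0 = sym (trans (+-identityʳ _) fZ≡0)
total-∑⊇-balanced p f (inside ∷ Z) fZ≡0 = begin
  total (∑⊇ f) (map (inside ∷_) (supersets Z (p ⁻¹)))       ≡⟨ total-∑⊇-inside f (supersets Z (p ⁻¹)) ⟩
  total (∑⊇ f₁) (supersets Z (p ⁻¹))                        ≡⟨ total-∑⊇-balanced (p ⁻¹) f₁ Z fZ≡0 ⟩
  total (∑⊇ f₁) (supersets Z (p ⁻¹ ⁻¹))                     ≡⟨ total-∑⊇-inside f (supersets Z (p ⁻¹ ⁻¹)) ⟨
  total (∑⊇ f) (map (inside ∷_) (supersets Z (p ⁻¹ ⁻¹)))    ∎
  where
  open ≡-Reasoning
  f₁ = f ∘ (inside ∷_)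
total-∑⊇-balanced p f (outside ∷ Z) fZ≡0 = begin
  total (∑⊇ f) (supersets (outside ∷ Z) p)
    ≡⟨ split p ⟩
  total (∑⊇ f₀) (supersets Z p) + (T p + T (p ⁻¹))
    -- The two blocks of the list contribute `T p` and `T (p ⁻¹)`, a sum symmetric in the parity;
    -- the hypothesis is spent on `f₀`, whose value at `Z` is the given zero.
    ≡⟨ cong₂ _+_ (total-∑⊇-balanced p f₀ Z fZ≡0) (+-comm (T p) _) ⟩
  total (∑⊇ f₀) (supersets Z (p ⁻¹)) + (T (p ⁻¹) + T p)
    ≡⟨ cong (λ q → total (∑⊇ f₀) (supersets Z (p ⁻¹)) + (T (p ⁻¹) + T q)) (⁻¹-involutive p) ⟨
  total (∑⊇ f₀) (supersets Z (p ⁻¹)) + (T (p ⁻¹) + T (p ⁻¹ ⁻¹))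
    ≡⟨ split (p ⁻¹) ⟨
  total (∑⊇ f) (supersets (outside ∷ Z) (p ⁻¹))
    ∎
  where
  open ≡-Reasoning
  f₀ = f ∘ (outside ∷_)
  f₁ = f ∘ (inside ∷_)

  T : Parity → ℤ
  T q = total (∑⊇ f₁) (supersets Z q)

  split : ∀ q → total (∑⊇ f) (supersets (outside ∷ Z) q) ≡
                total (∑⊇ f₀) (supersets Z q) + (T q + T (q ⁻¹))
  split q = begin
    total (∑⊇ f) (map (outside ∷_) (supersets Z q) ++ map (inside ∷_) (supersets Z (q ⁻¹)))
      ≡⟨ total-++ (∑⊇ f) (map (outside ∷_) (supersets Z q)) _ ⟩
    total (∑⊇ f) (map (outside ∷_) (supersets Z q)) +
    total (∑⊇ f) (map (inside ∷_) (supersets Z (q ⁻¹)))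
      ≡⟨ cong₂ _+_ (trans (total-map (∑⊇ f) _ (supersets Z q))
                          (total-+ (∑⊇ f₀) (∑⊇ f₁) (supersets Z q)))
                   (total-∑⊇-inside f (supersets Z (q ⁻¹))) ⟩
    (total (∑⊇ f₀) (supersets Z q) + T q) + T (q ⁻¹)
      ≡⟨ +-assoc (total (∑⊇ f₀) (supersets Z q)) _ _ ⟩
    total (∑⊇ f₀) (supersets Z q) + (T q + T (q ⁻¹))
      ∎

-- Upward sums of `μ̂` are indicators of `C`, so totalling them over a list counts its members in
-- `C`.
μ̂≡0⇒balanced : {C : Configuration n} (C? : Decidable C) (Z : Subset n) → μ̂ C? Z ≡ 0ℤ → ∀ p →
               length (filter C? (supersets Z p)) ≡ length (filter C? (supersets Z (p ⁻¹)))
μ̂≡0⇒balanced C? Z μ̂Z≡0 p = +-injective (begin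
  + length (filter C? (supersets Z p))          ≡⟨ count p ⟩
  total (∑⊇ (μ̂ C?)) (supersets Z p)             ≡⟨ total-∑⊇-balanced p (μ̂ C?) Z μ̂Z≡0 ⟩
  total (∑⊇ (μ̂ C?)) (supersets Z (p ⁻¹))        ≡⟨ count (p ⁻¹) ⟨
  + length (filter C? (supersets Z (p ⁻¹)))     ∎)
  where
  open ≡-Reasoning
  count : ∀ q → + length (filter C? (supersets Z q)) ≡ total (∑⊇ (μ̂ C?)) (supersets Z q)
  count q = trans (sym (total-𝟙 C? (supersets Z q))) (total-cong (𝟙≡∑⊇μ̂ C?) (supersets Z q))

-- Finite unions and pairs in a dot-algebra

module _ {F : Pred (Pred A 0ℓ) ℓ} where

  -- Indexing by subsets lets induction on `n` halve the family, leaving one binary disjoint union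
  -- at each stage.
  ⋃-∈• : (P : Subset n → Pred A 0ℓ) → (∀ Y → P Y ∈ • F) →
         (∀ {Y Y′} → Y ≢ Y′ → P Y ⊥ P Y′) → (λ x → ∃[ Y ] P Y x) ∈ • F
  ⋃-∈• {n = zero} P P∈• disj = resp-≐ ((λ p → [] , p) , λ { ([] , p) → p }) (P∈• [])
  ⋃-∈• {n = suc n} P P∈• disj =
    resp-≐ ((λ { (inj₁ (Y , p)) → outside ∷ Y , p ; (inj₂ (Y , p)) → inside ∷ Y , p }) ,
            (λ { (outside ∷ Y , p) → inj₁ (Y , p) ; (inside ∷ Y , p) → inj₂ (Y , p) }))
           (union (half outside) (half inside)
                  (λ ((_ , p) , (_ , q)) → disj (λ ()) (p , q)))
    where
    half : ∀ s → (λ x → ∃[ Y ] P (s ∷ Y) x) ∈ • F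
    half s = ⋃-∈• (P ∘ (s ∷_)) (P∈• ∘ (s ∷_)) (λ Y≢Y′ → disj (Y≢Y′ ∘ ∷-injectiveʳ))

  -- The preimage is the disjoint union of its fibres. Decidability of `Q` allows the part over a
  -- point outside `Q` to be replaced by the empty set.
  preimage-∈• : (g : A → Subset n) {Q : Pred (Subset n) 0ℓ} → Decidable Q →
                (∀ Y → Q Y → (λ x → g x ≡ Y) ∈ • F) → (λ x → Q (g x)) ∈ • F
  preimage-∈• g {Q} Q? fibre∈• =
    resp-≐ ((λ { (_ , refl , q) → q }) , λ q → _ , refl , q)
           (⋃-∈• (λ Y x → g x ≡ Y × Q Y) part∈•
                 (λ Y≢Y′ ((eq , _) , (eq′ , _)) → Y≢Y′ (trans (sym eq) eq′)))
    where
    part∈• : ∀ Y → (λ x → g x ≡ Y × Q Y) ∈ • F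
    part∈• Y with Q? Y
    ... | yes q = resp-≐ ((λ eq → eq , q) , proj₁) (fibre∈• Y q)
    ... | no ¬q = resp-≐ ((λ ()) , λ (_ , q) → ¬q q) empty

  Linked : A → A → Set _
  Linked x y = (｛ x ｝ ∪ ｛ y ｝) ∈ • F

  linked-sym : ∀ {x y} → Linked x y → Linked y x
  linked-sym = resp-≐ (Sum.swap , Sum.swap)

  -- Since `E` and `O` are disjoint, the only possible coincidences are `x ≡ x′` and `y ≡ y′`, where
  -- one of the given links is the answer. Otherwise the outer two pairs are disjoint and their
  -- union contains the middle pair.
  zigzag : DecidableEquality A → {E O : Pred A 0ℓ} → E ⊥ O → ∀ {x y x′ y′} →
           x ∈ E → x′ ∈ E → y ∈ O → y′ ∈ O →
           Linked x y → Linked x′ y → Linked x′ y′ → Linked x y′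
  zigzag _≟_ {E} {O} E⊥O {x} {y} {x′} {y′} x∈E x′∈E y∈O y′∈O xy x′y x′y′
    with x ≟ x′ | y ≟ y′
  ... | yes refl | _        = x′y′
  ... | no _     | yes refl = xy
  ... | no x≢x′  | no y≢y′  =
    resp-≐ ((λ { (inj₁ (inj₁ refl) , _) → inj₁ refl
               ; (inj₁ (inj₂ refl) , ∉) → contradiction (inj₂ refl) ∉
               ; (inj₂ (inj₁ refl) , ∉) → contradiction (inj₁ refl) ∉
               ; (inj₂ (inj₂ refl) , _) → inj₂ refl }) ,
            (λ { (inj₁ refl) → inj₁ (inj₁ refl) ,
                   λ { (inj₁ x′≡x) → x≢x′ (sym x′≡x) ; (inj₂ refl) → E⊥O (x∈E , y∈O) }
               ; (inj₂ refl) → inj₂ (inj₂ refl) ,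
                   λ { (inj₁ refl) → E⊥O (x′∈E , y′∈O) ; (inj₂ y≡y′) → y≢y′ y≡y′ } }))
           (complement
             (union xy x′y′
               (λ { (inj₁ refl , inj₁ x′≡x) → x≢x′ (sym x′≡x)
                  ; (inj₁ refl , inj₂ refl) → E⊥O (x∈E , y′∈O)
                  ; (inj₂ refl , inj₁ refl) → E⊥O (x′∈E , y∈O)
                  ; (inj₂ refl , inj₂ y′≡y) → y≢y′ (sym y′≡y) }))
             x′y
             (λ { (inj₁ refl) → inj₂ (inj₁ refl) ; (inj₂ refl) → inj₁ (inj₂ refl) }))

  -- Every cross pair is linked, so the lists can be matched in order; uniqueness and disjointness
  -- keep the pairs disjoint.
  matching-∈• : ∀ xs ys → length xs ≡ length ys → Unique xs → Unique ys →
                (_∈ᴸ xs) ⊥ (_∈ᴸ ys) → (∀ {x y} → x ∈ᴸ xs → y ∈ᴸ ys → Linked x y) →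
                ((_∈ᴸ xs) ∪ (_∈ᴸ ys)) ∈ • F
  matching-∈• []       []       _   _ _ _ _ = resp-≐ ((λ ()) , λ { (inj₁ ()) ; (inj₂ ()) }) empty
  matching-∈• (x ∷ xs) (y ∷ ys) len x∷xs! y∷ys! disj linked =
    resp-≐ ((λ { (inj₁ (inj₁ refl)) → inj₁ (here refl)
               ; (inj₁ (inj₂ refl)) → inj₂ (here refl)
               ; (inj₂ z∈)          → Sum.map there there z∈ }) ,
            (λ { (inj₁ (here refl)) → inj₁ (inj₁ refl)
               ; (inj₁ (there z∈))  → inj₂ (inj₁ z∈)
               ; (inj₂ (here refl)) → inj₁ (inj₂ refl)
               ; (inj₂ (there z∈))  → inj₂ (inj₂ z∈) }))
           (union (linked (here refl) (here refl))
                  (matching-∈• xs ys (suc-injective len) (tail! x∷xs!) (tail! y∷ys!)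
                    (λ (p , q) → disj (there p , there q)) (λ p q → linked (there p) (there q)))
                  (λ { (inj₁ refl , inj₁ x∈xs) → Unique.Unique[x∷xs]⇒x∉xs x∷xs! x∈xs
                     ; (inj₁ refl , inj₂ x∈ys) → disj (here refl , there x∈ys)
                     ; (inj₂ refl , inj₁ y∈xs) → disj (there y∈xs , here refl)
                     ; (inj₂ refl , inj₂ y∈ys) → Unique.Unique[x∷xs]⇒x∉xs y∷ys! y∈ys }))
    where
    tail! : ∀ {z zs} → Unique (z ∷ zs) → Unique {A = A} zs
    tail! (_ ∷ zs!) = zs!

-- The dot-algebra of the principal downsets other than 2^Z

module _ {I : Configuration n} (I? : Decidable I) (I↓ : IsDownset I) (Z : Subset n) where

  private
    Gens : Pred (Configuration n) 0ℓ
    Gens P = ∃[ X ] (X ∈ (I ∖ ｛ Z ｝) × P ≐ 2^ X)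

  -- The last hypothesis says that `Z` is not in the interval from `K` to `Y`. It makes `2^ Y` a
  -- generator and passes to every `Y′` between `K` and `Y`, so the fibres to be removed come from
  -- induction.
  ∪-fibre-∈• : ∀ K {Y} → Acc _⊂_ Y → I Y → K ⊆ˢ Y → (K ⊆ˢ Z → Z ⊈ˢ Y) →
               (λ X → X ∪ˢ K ≡ Y) ∈ • Gens
  ∪-fibre-∈• K {Y} (acc rec) Y∈I K⊆Y Z∉[K,Y] =
    resp-≐ ((λ (X⊆Y , ¬⊂) → ⊆∧⊄⇒≡ (∪-lub X⊆Y) (λ ⊂Y → ¬⊂ (⊂Y , q⊆p∪q _ K))) ,
            (λ { {X} refl → p⊆p∪q K , λ (⊂Y , _) → ⊂-irref refl ⊂Y }))
           (complement
             (generator (Y , (Y∈I , λ { refl → Z∉[K,Y] K⊆Y ⊆-refl }) , id , id))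
             -- Every value `X ∪ˢ K` contains `K`, so the conjunct `K ⊆ˢ Y′` excludes no fibre that
             -- has to be removed, and the recursive call receives it.
             (preimage-∈• (_∪ˢ K) (λ Y′ → (Y′ ⊂? Y) ×-dec (K ⊆? Y′))
               (λ Y′ (Y′⊂Y , K⊆Y′) →
                 ∪-fibre-∈• K (rec Y′⊂Y) (I↓ (proj₁ Y′⊂Y) Y∈I) K⊆Y′
                   (λ K⊆Z Z⊆Y′ → Z∉[K,Y] K⊆Z (⊆-trans Z⊆Y′ (proj₁ Y′⊂Y)))))
             (λ ((X∪K⊆Y , _) , _) → ⊆-trans (p⊆p∪q K) X∪K⊆Y))
    where
    ∪-lub : ∀ {X} → X ⊆ˢ Y → X ∪ˢ K ⊆ˢ Y
    ∪-lub X⊆Y = Sum.[ X⊆Y , K⊆Y ]′ ∘ x∈p∪q⁻ _ K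

  -- For `K = ⊥ˢ` the fibres are singletons, and the interval avoids `Z` exactly when `Z ⊈ˢ Y`.
  not-above-∈• : (λ X → I X × Z ⊈ˢ X) ∈ • Gens
  not-above-∈• = preimage-∈• id (λ X → I? X ×-dec ¬? (Z ⊆? X)) λ Y (Y∈I , Z⊈Y) →
    resp-≐ ((λ { {X} eq → trans (sym (∪-identityʳ X)) eq }) , λ { refl → ∪-identityʳ _ })
           (∪-fibre-∈• ⊥ˢ (⊂-wellFounded Y) Y∈I ⊥⊆ (λ _ → Z⊈Y))

  -- The fibre of adjoining `a` over `X`; as `a ∉ˢ Z`, no interval starting at `⁅ a ⁆` contains `Z`.
  edge : ∀ {X a} → I X → a ∈ˢ X → a ∉ˢ Z → Linked {F = Gens} X (X - a)
  edge {X} {a} X∈I a∈X a∉Z =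
    resp-≐ ((λ { {Y} refl → ∪⁅⁆-undo Y a }) ,
            (λ { (inj₁ refl) → ∪⁅⁆-absorb a∈X ; (inj₂ refl) → -∪⁅⁆ a∈X }))
           (∪-fibre-∈• ⁅ a ⁆ (⊂-wellFounded X) X∈I ⁅a⁆⊆X
             (λ ⁅a⁆⊆Z _ → a∉Z (⁅a⁆⊆Z (x∈⁅x⁆ a))))
    where
    ⁅a⁆⊆X : ⁅ a ⁆ ⊆ˢ X
    ⁅a⁆⊆X b∈⁅a⁆ with refl ← x∈⁅y⁆⇒x≡y a b∈⁅a⁆ = a∈X

  -- Linking sets of opposite parities above `Z`.

  private
    p = parity ∣ Z ∣

    -- Evenness is relative to `Z`, so `Z` itself always counts as even.
    Even Odd : Configuration n
    Even X = parity ∣ X ∣ ≡ p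
    Odd  X = parity ∣ X ∣ ≡ p ⁻¹

    Even⊥Odd : Even ⊥ Odd
    Even⊥Odd (even , odd) = p≢p⁻¹ p (trans (sym even) odd)

    ⊆-remove : ∀ {X a} → Z ⊆ˢ X → a ∉ˢ Z → Z ⊆ˢ X - a
    ⊆-remove Z⊆X a∉Z b∈Z = x∈p∧x≢y⇒x∈p-y (Z⊆X b∈Z) λ { refl → a∉Z b∈Z }

  -- An odd `X` above `Z` differs from `Z`, so some `a` outside `Z` can be removed. The edge from
  -- `X - a` to `X` is then transferred down to `Z`.
  linked-bottom : ∀ {X} → Acc _⊂_ X → Z ⊆ˢ X → I X → Odd X → Linked {F = Gens} Z X
  -- If `X` is not `Z`, then `Z` and `X` share the odd partner `X - a`, by `linked-bottom` and
  -- `edge`; `zigzag` through it exchanges them in either direction. The mutual recursion removes an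
  -- element at each call.
  linked-transfer : ∀ {X Y} → Acc _⊂_ X → Z ⊆ˢ X → I X → Even X → Odd Y →
                    (Linked {F = Gens} X Y → Linked {F = Gens} Z Y) ×
                    (Linked {F = Gens} Z Y → Linked {F = Gens} X Y)

  linked-bottom {X} (acc rec) Z⊆X X∈I X-odd with Z ⊂? X
  ... | no Z⊄X with refl ← ⊆∧⊄⇒≡ Z⊆X Z⊄X = contradiction (refl , X-odd) (Even⊥Odd {Z})
  ... | yes (_ , a , a∈X , a∉Z) =
    proj₁ (linked-transfer (rec X-a⊂X) (⊆-remove Z⊆X a∉Z) (I↓ (proj₁ X-a⊂X) X∈I)
             (trans (parity-remove a∈X) (trans (cong _⁻¹ X-odd) (⁻¹-involutive p))) X-odd)
          (linked-sym (edge X∈I a∈X a∉Z))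
    where
    X-a⊂X : X - a ⊂ X
    X-a⊂X = x∈p⇒p-x⊂p a∈X

  linked-transfer {X} (acc rec) Z⊆X X∈I X-even Y-odd with Z ⊂? X
  ... | no Z⊄X with refl ← ⊆∧⊄⇒≡ Z⊆X Z⊄X = id , id
  ... | yes (_ , a , a∈X , a∉Z) =
    zigzag _≟ˢ_ {Even} {Odd} (λ {X} → Even⊥Odd {X}) refl X-even X-a-odd Y-odd Z~X-a X~X-a ,
    zigzag _≟ˢ_ {Even} {Odd} (λ {X} → Even⊥Odd {X}) X-even refl X-a-odd Y-odd X~X-a Z~X-a
    where
    X-a⊂X : X - a ⊂ X
    X-a⊂X = x∈p⇒p-x⊂p a∈X
    X-a-odd : Odd (X - a)
    X-a-odd = trans (parity-remove a∈X) (cong _⁻¹ X-even)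
    X~X-a : Linked X (X - a)
    X~X-a = edge X∈I a∈X a∉Z
    Z~X-a : Linked Z (X - a)
    Z~X-a = linked-bottom (rec X-a⊂X) (⊆-remove Z⊆X a∉Z) (I↓ (proj₁ X-a⊂X) X∈I) X-a-odd

  -- The link from `Z` to `Y` is carried up from `Z` to `X`.
  opposite-linked : ∀ {X Y} → Z ⊆ˢ X → I X → Even X → Z ⊆ˢ Y → I Y → Odd Y →
                    Linked {F = Gens} X Y
  opposite-linked {X} {Y} Z⊆X X∈I X-even Z⊆Y Y∈I Y-odd =
    proj₂ (linked-transfer (⊂-wellFounded X) Z⊆X X∈I X-even Y-odd)
          (linked-bottom (⊂-wellFounded Y) Z⊆Y Y∈I Y-odd)

  above-∈• : μ̂ I? Z ≡ 0ℤ → (λ X → I X × Z ⊆ˢ X) ∈ • Gens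
  above-∈• μ̂Z≡0 =
    resp-≐ (Sum.[ (λ X∈ → let X∈I , Z⊆X , _ = members p X∈ in X∈I , λ {b} → Z⊆X {b})
                , (λ X∈ → let X∈I , Z⊆X , _ = members (p ⁻¹) X∈ in X∈I , λ {b} → Z⊆X {b}) ]′ ,
            λ {X} (X∈I , Z⊆X) →
              Sum.map (listed {X = X} X∈I Z⊆X) (listed {X = X} X∈I Z⊆X) (even⊎odd X))
           -- The vanishing of `μ̂ I? Z` enters only here, as the equality of the two lengths.
           (matching-∈• (sets p) (sets (p ⁻¹)) (μ̂≡0⇒balanced I? Z μ̂Z≡0 p)
             (Unique.filter⁺ I? (supersets-unique Z p))
             (Unique.filter⁺ I? (supersets-unique Z (p ⁻¹)))
             (λ {X} (X∈ , X∈′) →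
               Even⊥Odd {X} (proj₂ (proj₂ (members p X∈)) , proj₂ (proj₂ (members (p ⁻¹) X∈′))))
             (λ X∈ Y∈ → let X∈I , Z⊆X , X-even = members p X∈
                            Y∈I , Z⊆Y , Y-odd  = members (p ⁻¹) Y∈
                        in opposite-linked Z⊆X X∈I X-even Z⊆Y Y∈I Y-odd))
    where
    sets : Parity → List (Subset n)
    sets q = filter I? (supersets Z q)

    members : ∀ q {X} → X ∈ᴸ sets q → I X × Z ⊆ˢ X × parity ∣ X ∣ ≡ q
    members q X∈ with X∈supersets , X∈I ← ∈-filter⁻ I? {xs = supersets Z q} X∈ =
      X∈I , ∈-supersets⁻ Z q X∈supersets

    listed : ∀ {q X} → I X → Z ⊆ˢ X → parity ∣ X ∣ ≡ q → X ∈ᴸ sets q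
    listed {q} X∈I Z⊆X eq = ∈-filter⁺ I? (∈-supersets⁺ Z q Z⊆X eq) X∈I

    even⊎odd : ∀ X → Even X ⊎ Odd X
    even⊎odd X with parity ∣ X ∣ | p
    ... | 0ℙ | 0ℙ = inj₁ refl
    ... | 0ℙ | 1ℙ = inj₂ refl
    ... | 1ℙ | 0ℙ = inj₂ refl
    ... | 1ℙ | 1ℙ = inj₁ refl

theorem6p2 : (n : ℕ) (I : Configuration n) (I? : Decidable I) → IsDownset I →
    (Z : Subset n) → Z ∈ I → μ̂ I? Z ≡ 0ℤ →
    I ∈ • (λ P → ∃[ X ] (X ∈ (I ∖ ｛ Z ｝) × P ≐ 2^ X))
theorem6p2 n I I? I↓ Z _ μ̂Z≡0 =
  -- The sets of `I` not above `Z` are covered by singletons, those above `Z` by pairs.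
  resp-≐ (Sum.[ proj₁ , proj₁ ]′ , λ {X} → split X)
         (union (not-above-∈• I? I↓ Z) (above-∈• I? I↓ Z μ̂Z≡0)
                (λ ((_ , Z⊈X) , (_ , Z⊆X)) → Z⊈X Z⊆X))
  where
  split : ∀ X → I X → (I X × Z ⊈ˢ X) ⊎ (I X × Z ⊆ˢ X)
  split X X∈I with Z ⊆? X
  ... | yes Z⊆X = inj₂ (X∈I , Z⊆X)
  ... | no  Z⊈X = inj₁ (X∈I , Z⊈X)
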